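{- For every formula $F$ of the language of $\mathsf{S4V}$: if $\mathsf{S4V}\vdash F$ then there is a normal realisation $r$ such that $\mathsf{LPV}\vdash F^r$.
   Context: $\mathsf{S4V}$: classical modal logic with two unary modalities $\Box$ and ${\bf V}$; axioms: all axioms of $\mathsf{S4}$ for $\Box$, ${\bf V}(A\rightarrow B)\rightarrow({\bf V}A\rightarrow{\bf V}B)$, $\Box A\rightarrow{\bf V}A$, $\neg\Box{\bf V}\bot$; rules: Modus Ponens and $\Box$-Necessitation. $\mathsf{LPV}$: language of classical propositional logic extended by ${\bf V}A$ and $t{:}A$, with proof terms built from proof variables and proof constants by binary $\cdot$, $+$ and unary $!$. Axioms: classical propositional tautologies; $t{:}(A\rightarrow B)\rightarrow(s{:}A\rightarrow (t\cdot s){:}B)$; $t{:}A\rightarrow A$; $t{:}A\rightarrow\, !t{:}t{:}A$; $t{:}A\rightarrow (s+t){:}A$, $t{:}A\rightarrow (t+s){:}A$; ${\bf V}(A\rightarrow B)\rightarrow({\bf V}A\rightarrow {\bf V}B)$; $t{:}A\rightarrow {\bf V}A$; $\neg t{:}{\bf V}\bot$. Rules: Modus Ponens and Axiom Necessitation (from an axiom $A$ infer $c{:}A$, $c$ a proof constant). A realisation $r$ of an $\mathsf{S4V}$ formula $F$ replaces each occurrence of $\Box$ in $F$ by a proof term (so $\Box G$ becomes $t{:}G^r$), yielding an $\mathsf{LPV}$ formula $F^r$. Polarity of occurrences of $\Box$: an occurrence in $F$ keeps its polarity in $G\rightarrow F$, $F\land G$, $G\land F$, $F\lor G$, $G\lor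 F$, $\Box F$, and reverses it in $F\rightarrow G$ and $\neg F$; the outermost occurrence in $\Box G$ as a whole formula is positive. A realisation is normal if every negative occurrence of $\Box$ is replaced by a proof variable. -}

module Defs where

open import Data.Nat using (ℕ)
open import Data.Bool using (Bool; true; false; _∧_; _∨_; not)
open import Data.Product using (_×_; _,_; ∃-syntax)
open import Data.Unit using (⊤; tt)
open import Relation.Binary.PropositionalEquality using (_≡_)

infixr 5 _⇒_
infixr 6 _∨ₘ_
infixr 7 _∧ₘ_

data Fm : Set where
  var   : ℕ → Fm
  ⊥ₘ    : Fm
  ¬ₘ_   : Fm → Fm
  _∧ₘ_  : Fm → Fm → Fm
  _∨ₘ_  : Fm → Fm → Fm
  _⇒_   : Fm → Fm → Fm
  □_    : Fm → Fm
  V_    : Fm → Fm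

evalₘ : (Fm → Bool) → Fm → Bool
evalₘ v (var n)  = v (var n)
evalₘ v ⊥ₘ       = false
evalₘ v (¬ₘ A)   = not (evalₘ v A)
evalₘ v (A ∧ₘ B) = evalₘ v A ∧ evalₘ v B
evalₘ v (A ∨ₘ B) = evalₘ v A ∨ evalₘ v B
evalₘ v (A ⇒ B)  = not (evalₘ v A) ∨ evalₘ v B
evalₘ v (□ A)    = v (□ A)
evalₘ v (V A)    = v (V A)

TautologyS4V : Fm → Set
TautologyS4V A = ∀ (v : Fm → Bool) → evalₘ v A ≡ true

data S4V⊢_ : Fm → Set where
  taut : ∀ {A} → TautologyS4V A → S4V⊢ A
  axK  : ∀ {A B} → S4V⊢ (□ (A ⇒ B) ⇒ (□ A ⇒ □ B))
  axT  : ∀ {A} → S4V⊢ (□ A ⇒ A)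
  ax4  : ∀ {A} → S4V⊢ (□ A ⇒ □ □ A)
  axVK : ∀ {A B} → S4V⊢ (V (A ⇒ B) ⇒ (V A ⇒ V B))
  ax□V : ∀ {A} → S4V⊢ (□ A ⇒ V A)
  axC  : S4V⊢ (¬ₘ □ V ⊥ₘ)
  mp   : ∀ {A B} → S4V⊢ (A ⇒ B) → S4V⊢ A → S4V⊢ B
  nec  : ∀ {A} → S4V⊢ A → S4V⊢ (□ A)

infixl 8 _·_
infixl 7 _+ₜ_

data Tm : Set where
  pvar   : ℕ → Tm
  pconst : ℕ → Tm
  _·_    : Tm → Tm → Tm
  _+ₜ_   : Tm → Tm → Tm
  !_     : Tm → Tm

infixr 5 _⇒ˡ_
infixr 6 _∨ˡ_
infixr 7 _∧ˡ_
infix 9 _∶_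

data LFm : Set where
  var   : ℕ → LFm
  ⊥ˡ    : LFm
  ¬ˡ_   : LFm → LFm
  _∧ˡ_  : LFm → LFm → LFm
  _∨ˡ_  : LFm → LFm → LFm
  _⇒ˡ_  : LFm → LFm → LFm
  Vˡ_   : LFm → LFm
  _∶_   : Tm → LFm → LFm

evalˡ : (LFm → Bool) → LFm → Bool
evalˡ v (var n)  = v (var n)
evalˡ v ⊥ˡ       = false
evalˡ v (¬ˡ A)   = not (evalˡ v A)
evalˡ v (A ∧ˡ B) = evalˡ v A ∧ evalˡ v B
evalˡ v (A ∨ˡ B) = evalˡ v A ∨ evalˡ v B
evalˡ v (A ⇒ˡ B) = not (evalˡ v A) ∨ evalˡ v B
evalˡ v (Vˡ A)   = v (Vˡ A)
evalˡ v (t ∶ A)  = v (t ∶ A)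

TautologyLPV : LFm → Set
TautologyLPV A = ∀ (v : LFm → Bool) → evalˡ v A ≡ true

data LPVAxiom : LFm → Set where
  taut  : ∀ {A} → TautologyLPV A → LPVAxiom A
  app   : ∀ {t s A B} → LPVAxiom (t ∶ (A ⇒ˡ B) ⇒ˡ (s ∶ A ⇒ˡ (t · s) ∶ B))
  refl  : ∀ {t A} → LPVAxiom (t ∶ A ⇒ˡ A)
  check : ∀ {t A} → LPVAxiom (t ∶ A ⇒ˡ (! t) ∶ (t ∶ A))
  sumˡ  : ∀ {t s A} → LPVAxiom (t ∶ A ⇒ˡ (s +ₜ t) ∶ A)
  sumʳ  : ∀ {t s A} → LPVAxiom (t ∶ A ⇒ˡ (t +ₜ s) ∶ A)
  vK    : ∀ {A B} → LPVAxiom (Vˡ (A ⇒ˡ B) ⇒ˡ (Vˡ A ⇒ˡ Vˡ B))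
  jV    : ∀ {t A} → LPVAxiom (t ∶ A ⇒ˡ Vˡ A)
  cons  : ∀ {t} → LPVAxiom (¬ˡ (t ∶ (Vˡ ⊥ˡ)))

data LPV⊢_ : LFm → Set where
  ax   : ∀ {A} → LPVAxiom A → LPV⊢ A
  mp   : ∀ {A B} → LPV⊢ (A ⇒ˡ B) → LPV⊢ A → LPV⊢ B
  anec : ∀ {A} (c : ℕ) → LPVAxiom A → LPV⊢ (pconst c ∶ A)

Realisation : Fm → Set
Realisation (var n)  = ⊤
Realisation ⊥ₘ       = ⊤
Realisation (¬ₘ A)   = Realisation A
Realisation (A ∧ₘ B) = Realisation A × Realisation B
Realisation (A ∨ₘ B) = Realisation A × Realisation B
Realisation (A ⇒ B)  = Realisation A × Realisation B
Realisation (□ A)    = Tm × Realisation A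
Realisation (V A)    = Realisation A

realise : (F : Fm) → Realisation F → LFm
realise (var n)  _        = var n
realise ⊥ₘ       _        = ⊥ˡ
realise (¬ₘ A)   r        = ¬ˡ realise A r
realise (A ∧ₘ B) (r , s)  = realise A r ∧ˡ realise B s
realise (A ∨ₘ B) (r , s)  = realise A r ∨ˡ realise B s
realise (A ⇒ B)  (r , s)  = realise A r ⇒ˡ realise B s
realise (□ A)    (t , r)  = t ∶ realise A r
realise (V A)    r        = Vˡ realise A r

IsVar : Tm → Set
IsVar t = ∃[ n ] (t ≡ pvar n)

-- NormalAt p F r : every □-occurrence of F that is negative, when F itself
-- occurs with polarity p (true = positive), is realised by a proof variable.
NormalAt : Bool → (F : Fm) → Realisation F → Set
NormalAt p (var n)  _       = ⊤
NormalAt p ⊥ₘ       _       = ⊤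
NormalAt p (¬ₘ A)   r       = NormalAt (not p) A r
NormalAt p (A ∧ₘ B) (r , s) = NormalAt p A r × NormalAt p B s
NormalAt p (A ∨ₘ B) (r , s) = NormalAt p A r × NormalAt p B s
NormalAt p (A ⇒ B)  (r , s) = NormalAt (not p) A r × NormalAt p B s
NormalAt true  (□ A) (t , r) = NormalAt true A r
NormalAt false (□ A) (t , r) = IsVar t × NormalAt false A r
NormalAt p (V A)    r       = NormalAt p A r

Normal : (F : Fm) → Realisation F → Set
Normal F r = NormalAt true F r

{-# OPTIONS --safe #-}
module Submission where

-- In a cut-free proof every positive □ stays positive, so the positive boxes
-- can be realised by the terms that the right rules for □ introduce.  Since
-- neither the variables nor the constants need to be distinct, all negative
-- boxes are realised by one variable, all positive boxes by one sum T of these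
-- terms, and every axiom is justified by one constant.  A term that internalises
-- a proof then depends only on the shape of the proof, not on the formulas in
-- it; so the summands of T can be computed before T itself, although T occurs
-- in the formulas they justify.

open import Defs
open import Data.Bool using (Bool; true; false; not; _∧_; _∨_)
open import Data.Bool.Properties using (not-involutive; ∨-zeroʳ)
open import Data.Empty using (⊥-elim)
open import Data.List using (List; []; _∷_; _++_; map; foldr)
open import Data.List.Membership.Propositional using (_∈_; lose)
open import Data.List.Membership.Propositional.Properties using (∈-++⁻)
open import Data.List.Relation.Binary.Subset.Propositional using (_⊆_)
open import Data.List.Relation.Binary.Subset.Propositional.Properties
  using (Any-resp-⊆; ∷⁺ʳ; ++⁺ʳ; ++⁺; map⁺; xs⊆xs++ys; xs⊆ys++xs)
open import Data.List.Relation.Unary.All using (All; []; _∷_)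
import Data.List.Relation.Unary.All.Properties as All
open import Data.List.Relation.Unary.Any as Any using (Any; here; there)
import Data.List.Relation.Unary.Any.Properties as Any
open import Data.Maybe as Maybe using (Maybe; just; nothing)
open import Data.Nat using (_≟_)
open import Data.Nat.Properties using (≟-diag)
open import Data.Product using (Σ; ∃; _×_; _,_; proj₁; proj₂; map₂)
open import Data.Sum as Sum using (_⊎_; inj₁; inj₂; [_,_]′)
open import Data.Unit using (tt)
open import Function using (_∘_; id; const)
open import Relation.Binary.PropositionalEquality
  using (_≡_; _≢_; refl; sym; trans; cong; cong₂)
open import Relation.Nullary.Decidable using (dec⇒maybe)

-- A cut-free calculus

-- A sequent is read as the disjunction of its signed formulas, A ⁻ standing
-- for the negation of A.
Signed : Set
Signed = Bool × Fm

Sequent : Set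
Sequent = List Signed

infix 25 _⁺ _⁻
pattern _⁺ A = true , A
pattern _⁻ A = false , A

neg : List Fm → Sequent
neg = map (false ,_)

neg□ negV : List Fm → Sequent
neg□ As = neg (map □_ As)
negV As = neg (map V_ As)

infix 4 _⟶_

-- A table from a principal formula to the parts that its premises add to the context, so that
-- removal and inversion treat all propositional rules at once.
data _⟶_ : Signed → List Sequent → Set where
  ⊥⁺ : ⊥ₘ ⁺ ⟶ [] ∷ []
  ⊥⁻ : ⊥ₘ ⁻ ⟶ []
  ¬± : ∀ {b A} → (b , ¬ₘ A) ⟶ ((not b , A) ∷ []) ∷ []
  ∧⁺ : ∀ {A B} → (A ∧ₘ B) ⁺ ⟶ (A ⁺ ∷ []) ∷ (B ⁺ ∷ []) ∷ []
  ∧⁻ : ∀ {A B} → (A ∧ₘ B) ⁻ ⟶ (A ⁻ ∷ B ⁻ ∷ []) ∷ []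
  ∨⁺ : ∀ {A B} → (A ∨ₘ B) ⁺ ⟶ (A ⁺ ∷ B ⁺ ∷ []) ∷ []
  ∨⁻ : ∀ {A B} → (A ∨ₘ B) ⁻ ⟶ (A ⁻ ∷ []) ∷ (B ⁻ ∷ []) ∷ []
  ⇒⁺ : ∀ {A B} → (A ⇒ B) ⁺ ⟶ (A ⁻ ∷ B ⁺ ∷ []) ∷ []
  ⇒⁻ : ∀ {A B} → (A ⇒ B) ⁻ ⟶ (A ⁺ ∷ []) ∷ (B ⁻ ∷ []) ∷ []

⟶-functional : ∀ {φ Ps Qs} → φ ⟶ Ps → φ ⟶ Qs → Ps ≡ Qs
⟶-functional ⊥⁺ ⊥⁺ = refl
⟶-functional ⊥⁻ ⊥⁻ = refl
⟶-functional ¬± ¬± = refl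
⟶-functional ∧⁺ ∧⁺ = refl
⟶-functional ∧⁻ ∧⁻ = refl
⟶-functional ∨⁺ ∨⁺ = refl
⟶-functional ∨⁻ ∨⁻ = refl
⟶-functional ⇒⁺ ⇒⁺ = refl
⟶-functional ⇒⁻ ⇒⁻ = refl

infix 4 ⊢_

-- The axiom ¬ □ V ⊥ becomes the rule con, whose premise has V ⊥ on the right.
data ⊢_ (Γ : Sequent) : Set where
  atom : ∀ {n} → var n ⁺ ∈ Γ → var n ⁻ ∈ Γ → ⊢ Γ
  prop : ∀ {φ Ps} → φ ∈ Γ → φ ⟶ Ps → (∀ {P} → P ∈ Ps → ⊢ P ++ Γ) → ⊢ Γ
  box⁻ : ∀ {A} → (□ A) ⁻ ∈ Γ → ⊢ A ⁻ ∷ Γ → ⊢ Γ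
  box⁺ : ∀ {A} Bs → (□ A) ⁺ ∈ Γ → neg□ Bs ⊆ Γ → ⊢ A ⁺ ∷ neg□ Bs → ⊢ Γ
  ver  : ∀ {A} Bs Cs → (V A) ⁺ ∈ Γ → neg□ Bs ⊆ Γ → negV Cs ⊆ Γ →
         ⊢ A ⁺ ∷ neg□ Bs ++ neg Cs → ⊢ Γ
  con  : ∀ Bs → neg□ Bs ⊆ Γ → ⊢ (V ⊥ₘ) ⁺ ∷ neg□ Bs → ⊢ Γ

-- Weakening, removal of a formula, and inversion

contract : ∀ {a} {X : Set a} {x : X} {xs} → x ∈ xs → x ∷ xs ⊆ xs
contract x∈xs (here refl) = x∈xs
contract x∈xs (there y∈xs) = y∈xs

++-lub : ∀ {a} {X : Set a} (xs : List X) {ys zs} → xs ⊆ zs → ys ⊆ zs → xs ++ ys ⊆ zs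
++-lub xs f g = [ f , g ]′ ∘ ∈-++⁻ xs

exchange : ∀ {a} {X : Set a} {x : X} ys {zs} → ys ++ x ∷ zs ⊆ x ∷ ys ++ zs
exchange {x = x} ys {zs} =
  ++-lub ys (there ∘ xs⊆xs++ys ys zs) (∷⁺ʳ x (xs⊆ys++xs zs ys))

under : ∀ {a} {X : Set a} {x : X} {xs zs} ys → xs ⊆ x ∷ zs → ys ++ xs ⊆ x ∷ ys ++ zs
under ys f = exchange ys ∘ ++⁺ʳ ys f

weaken : ∀ {Γ Δ} → Γ ⊆ Δ → ⊢ Γ → ⊢ Δ
weaken f (atom p q)       = atom (f p) (f q)
weaken f (prop p e ds)    = prop (f p) e λ {P} m → weaken (++⁺ʳ P f) (ds m)
weaken f (box⁻ p d)       = box⁻ (f p) (weaken (∷⁺ʳ _ f) d)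
weaken f (box⁺ Bs p s d)  = box⁺ Bs (f p) (f ∘ s) d
weaken f (ver Bs Cs p s u d) = ver Bs Cs (f p) (f ∘ s) (f ∘ u) d
weaken f (con Bs s d)     = con Bs (f ∘ s) d

-- What the last rule of a derivation provides when φ is its principal formula
-- and φ has already been removed from those premises that inherit the context.
data Principal : Signed → Sequent → Set where
  atom⁺ : ∀ {n Δ} → var n ⁻ ∈ Δ → Principal (var n ⁺) Δ
  prop± : ∀ {φ Ps Δ} → φ ⟶ Ps → (∀ {P} → P ∈ Ps → ⊢ P ++ Δ) → Principal φ Δ
  □⁺ : ∀ {A Δ} Bs → neg□ Bs ⊆ Δ → ⊢ A ⁺ ∷ neg□ Bs → Principal ((□ A) ⁺) Δ
  V⁺ : ∀ {A Δ} Bs Cs → neg□ Bs ⊆ Δ → negV Cs ⊆ Δ →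
       ⊢ A ⁺ ∷ neg□ Bs ++ neg Cs → Principal ((V A) ⁺) Δ

-- Excluded are negative variables, boxes and `V`-formulas. The latter two can be side formulas of a
-- modal rule and would have to be pursued into its premise.
data Removable : Signed → Set where
  pos : ∀ {A} → Removable (A ⁺)
  compound : ∀ {φ Ps} → φ ⟶ Ps → Removable φ

removable-□⁻ : ∀ {A} {X : Set} → Removable ((□ A) ⁻) → X
removable-□⁻ (compound ())

removable-V⁻ : ∀ {A} {X : Set} → Removable ((V A) ⁻) → X
removable-V⁻ (compound ())

removable-var⁻ : ∀ {n} {X : Set} → Removable (var n ⁻) → X
removable-var⁻ (compound ())

strip : ∀ {φ Δ} (M : Fm → Fm) As → (∀ {A} → φ ≢ (M A) ⁻) →
        neg (map M As) ⊆ φ ∷ Δ → neg (map M As) ⊆ Δ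
strip M (A ∷ As) ne f (here refl) with f (here refl)
... | here eq = ⊥-elim (ne (sym eq))
... | there m = m
strip M (A ∷ As) ne f (there m) = strip M As ne (f ∘ there) m

-- Γ ⊆ φ ∷ Δ builds weakening and exchange into the induction hypothesis, so
-- that the recursion is structural.
remove : ∀ {φ Γ Δ} → Removable φ →
         (∀ {Δ′} → Δ ⊆ Δ′ → Principal φ Δ′ → ⊢ Δ′) → ⊢ Γ → Γ ⊆ φ ∷ Δ → ⊢ Δ
remove {φ} r h = go id
  where
  no-□ : ∀ {A} → φ ≢ (□ A) ⁻
  no-□ refl = removable-□⁻ r

  no-V : ∀ {A} → φ ≢ (V A) ⁻
  no-V refl = removable-V⁻ r

  -- The context grows on the way up; `i` keeps the original one inside it, as `h` demands.
  go : ∀ {Γ Δ′} → _ ⊆ Δ′ → ⊢ Γ → Γ ⊆ φ ∷ Δ′ → ⊢ Δ′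
  go i (atom p q) f with f p | f q
  ... | here refl | here ()
  ... | here refl | there q′ = h i (atom⁺ q′)
  ... | there _   | here refl = removable-var⁻ r
  ... | there p′  | there q′ = atom p′ q′
  go {Δ′ = Δ′} i (prop p e ds) f with f p
  ... | here refl = h i (prop± e λ {P} m → go (xs⊆ys++xs Δ′ P ∘ i) (ds m) (under P f))
  ... | there p′  = prop p′ e λ {P} m → go (xs⊆ys++xs Δ′ P ∘ i) (ds m) (under P f)
  go i (box⁻ {A} p d) f with f p
  ... | here refl = removable-□⁻ r
  ... | there p′  = box⁻ p′ (go (there ∘ i) d (under (A ⁻ ∷ []) f))
  -- The recursion stops at `box⁺`, `ver` and `con`: `φ` is none of their side formulas, so their
  -- premise is kept unchanged.
  go i (box⁺ Bs p s d) f with f p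
  ... | here refl = h i (□⁺ Bs (strip □_ Bs no-□ (f ∘ s)) d)
  ... | there p′  = box⁺ Bs p′ (strip □_ Bs no-□ (f ∘ s)) d
  go i (ver Bs Cs p s u d) f with f p
  ... | here refl = h i (V⁺ Bs Cs (strip □_ Bs no-□ (f ∘ s)) (strip V_ Cs no-V (f ∘ u)) d)
  ... | there p′  = ver Bs Cs p′ (strip □_ Bs no-□ (f ∘ s)) (strip V_ Cs no-V (f ∘ u)) d
  go i (con Bs s d) f = con Bs (strip □_ Bs no-□ (f ∘ s)) d

-- With `P` added to the context, `φ` is removed: where it is principal, `⟶-functional` finds `P`
-- among the premises of that rule, and the second copy of `P` is contracted.
invert : ∀ {φ Ps P Δ} → φ ⟶ Ps → P ∈ Ps → ⊢ φ ∷ Δ → ⊢ P ++ Δ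
invert {φ} {P = P} {Δ} e m d =
  remove (compound e) (principal e m) d (∷⁺ʳ φ (xs⊆ys++xs Δ P))
  where
  principal : ∀ {φ Ps Δ′} → φ ⟶ Ps → P ∈ Ps → P ++ Δ ⊆ Δ′ → Principal φ Δ′ → ⊢ Δ′
  principal e m i (prop± e′ ds) with refl ← ⟶-functional e e′ =
    weaken (++-lub P (i ∘ xs⊆xs++ys P Δ) id) (ds m)
  principal () m i (atom⁺ _)
  principal () m i (□⁺ _ _ _)
  principal () m i (V⁺ _ _ _ _ _)

-- Admissibility of cut

-- The side formulas of a modal rule may include the cut formula. `Bs′` keeps those located in `Δ`;
-- the others equal `A` by injectivity of `M`.
split : ∀ {A Δ} (M : Fm → Fm) → (∀ {A B} → M A ≡ M B → A ≡ B) → ∀ Bs →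
        neg (map M Bs) ⊆ (M A) ⁻ ∷ Δ →
        ∃ λ Bs′ → neg (map M Bs′) ⊆ Δ × Bs ⊆ A ∷ Bs′
split M inj [] f = [] , (λ ()) , (λ ())
split M inj (B ∷ Bs) f with f (here refl) | split M inj Bs (f ∘ there)
... | here eq | Bs′ , s , u = Bs′ , s , λ
  { (here refl) → here (inj (cong proj₂ eq)) ; (there m) → u m }
... | there m′ | Bs′ , s , u = B ∷ Bs′ , contract m′ ∘ ∷⁺ʳ _ s , λ
  { (here refl) → there (here refl) ; (there m) → ∷⁺ʳ _ there (u m) }

neg⊆ : ∀ {As Bs} → As ⊆ Bs → neg As ⊆ neg Bs
neg⊆ = map⁺ (false ,_)

neg□⊆ : ∀ {As Bs} → As ⊆ Bs → neg□ As ⊆ neg□ Bs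
neg□⊆ s = neg⊆ (map⁺ □_ s)

neg-map-++ : ∀ (M : Fm → Fm) As {Bs Γ} → neg (map M As) ⊆ Γ → neg (map M Bs) ⊆ Γ →
             neg (map M (As ++ Bs)) ⊆ Γ
neg-map-++ M [] f g m = g m
neg-map-++ M (A ∷ As) f g (here refl) = f (here refl)
neg-map-++ M (A ∷ As) f g (there m) = neg-map-++ M As (f ∘ there) g m

□-injective : ∀ {A B} → □ A ≡ □ B → A ≡ B
□-injective refl = refl

V-injective : ∀ {A B} → V A ≡ V B → A ≡ B
V-injective refl = refl

CutOn : Fm → Set
CutOn A = ∀ {Δ} → ⊢ A ⁺ ∷ Δ → ⊢ A ⁻ ∷ Δ → ⊢ Δ

-- The case where `box⁺` introduces the cut formula on the left, by recursion on the right
-- derivation. Taking the cut on `A` as an argument keeps the recursion of `cut` on formulas only.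
cut-□⁻ : ∀ {A Γ Δ} Bs → CutOn A → ⊢ A ⁺ ∷ neg□ Bs → ⊢ Γ → Γ ⊆ (□ A) ⁻ ∷ Δ →
         neg□ Bs ⊆ Δ → ⊢ Δ
cut-□⁻ {A} Bs cutA d₀ = go
  where
  go : ∀ {Γ Δ} → ⊢ Γ → Γ ⊆ (□ A) ⁻ ∷ Δ → neg□ Bs ⊆ Δ → ⊢ Δ
  go (atom p q) f b with f p | f q
  ... | there p′ | there q′ = atom p′ q′
  go {Δ = Δ} (prop p e ds) f b with f p
  ... | here refl with () ← e
  ... | there p′ = prop p′ e λ {P} m → go (ds m) (under P f) (xs⊆ys++xs Δ P ∘ b)
  go (box⁻ {B} p d) f b with f p | go d (under (B ⁻ ∷ []) f) (there ∘ b)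
  -- Principal case: the recursive call has already removed `□ A` from the premise, which leaves a
  -- cut on `A`.
  ... | here refl | d′ = cutA (weaken (∷⁺ʳ _ b) d₀) d′
  ... | there p′  | d′ = box⁻ p′ d′
  go (box⁺ {C} Bs₂ p s d) f b with f p | split □_ □-injective Bs₂ (f ∘ s)
  ... | there p′ | Bs′ , s′ , u =
    -- The boxed formulas `Bs` join the side formulas, so that they reach the premise, where `□ A`
    -- is still to be eliminated.
    box⁺ (Bs′ ++ Bs) p′ (neg-map-++ □_ Bs′ s′ b)
      (go d (under (C ⁺ ∷ []) (∷⁺ʳ _ (neg□⊆ (xs⊆xs++ys Bs′ Bs)) ∘ neg□⊆ u))
            (there ∘ neg□⊆ (xs⊆ys++xs Bs Bs′)))
  go (ver {C} Bs₂ Cs p s v d) f b with f p | split □_ □-injective Bs₂ (f ∘ s)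
  ... | there p′ | Bs′ , s′ , u =
    ver (Bs′ ++ Bs) Cs p′ (neg-map-++ □_ Bs′ s′ b) (strip V_ Cs (λ ()) (f ∘ v))
      (go d (under (C ⁺ ∷ [])
              (++⁺ (∷⁺ʳ _ (neg□⊆ (xs⊆xs++ys Bs′ Bs)) ∘ neg□⊆ u) id))
            (there ∘ xs⊆xs++ys _ _ ∘ neg□⊆ (xs⊆ys++xs Bs Bs′)))
  go (con Bs₂ s d) f b with split □_ □-injective Bs₂ (f ∘ s)
  ... | Bs′ , s′ , u =
    con (Bs′ ++ Bs) (neg-map-++ □_ Bs′ s′ b)
      (go d (under (_ ∷ []) (∷⁺ʳ _ (neg□⊆ (xs⊆xs++ys Bs′ Bs)) ∘ neg□⊆ u))
            (there ∘ neg□⊆ (xs⊆ys++xs Bs Bs′)))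

-- A negative `V A` is used only as a side formula of `ver`, whose premise contains `A ⁻` in its
-- place. One cut on `A` there replaces it by the side formulas `Bs` and `Cs`.
cut-V⁻ : ∀ {A Γ Δ} Bs Cs → CutOn A → ⊢ A ⁺ ∷ neg□ Bs ++ neg Cs → ⊢ Γ →
         Γ ⊆ (V A) ⁻ ∷ Δ → neg□ Bs ⊆ Δ → negV Cs ⊆ Δ → ⊢ Δ
cut-V⁻ {A} Bs Cs cutA d₀ = go
  where
  go : ∀ {Γ Δ} → ⊢ Γ → Γ ⊆ (V A) ⁻ ∷ Δ → neg□ Bs ⊆ Δ → negV Cs ⊆ Δ → ⊢ Δ
  go (atom p q) f b c with f p | f q
  ... | there p′ | there q′ = atom p′ q′
  go {Δ = Δ} (prop p e ds) f b c with f p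
  ... | here refl with () ← e
  ... | there p′ = prop p′ e λ {P} m →
    go (ds m) (under P f) (xs⊆ys++xs Δ P ∘ b) (xs⊆ys++xs Δ P ∘ c)
  go (box⁻ {B} p d) f b c with f p
  ... | there p′ = box⁻ p′ (go d (under (B ⁻ ∷ []) f) (there ∘ b) (there ∘ c))
  go (box⁺ Bs₂ p s d) f b c with f p
  ... | there p′ = box⁺ Bs₂ p′ (strip □_ Bs₂ (λ ()) (f ∘ s)) d
  go (ver {C} Bs₂ Cs₂ p s v d) f b c with f p | split V_ V-injective Cs₂ (f ∘ v)
  ... | there p′ | Cs′ , v′ , u =
    ver (Bs₂ ++ Bs) (Cs′ ++ Cs) p′
      (neg-map-++ □_ Bs₂ (strip □_ Bs₂ (λ ()) (f ∘ s)) b) (neg-map-++ V_ Cs′ v′ c)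
      (cutA
        (weaken (∷⁺ʳ _ (there ∘ ++⁺ (neg□⊆ (xs⊆ys++xs Bs Bs₂)) (neg⊆ (xs⊆ys++xs Cs Cs′))))
          d₀)
        (weaken (under (C ⁺ ∷ []) (under (neg□ (Bs₂ ++ Bs))
                  (∷⁺ʳ _ (neg⊆ (xs⊆xs++ys Cs′ Cs)) ∘ neg⊆ u)
                ∘ ++⁺ (neg□⊆ (xs⊆xs++ys Bs₂ Bs)) id))
          d))
  go (con Bs₂ s d) f b c = con Bs₂ (strip □_ Bs₂ (λ ()) (f ∘ s)) d

-- Induction on the formula alone. Connectives are inverted on both sides; a variable or modal
-- formula is removed from the left derivation, and the right one is consulted where it is
-- principal.
cut : ∀ A → CutOn A
cut (var n) {Δ} d₁ d₂ = remove pos principal d₁ id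
  where
  principal : ∀ {Δ′} → Δ ⊆ Δ′ → Principal (var n ⁺) Δ′ → ⊢ Δ′
  principal i (atom⁺ q) = weaken (contract q ∘ ∷⁺ʳ _ i) d₂
  principal i (prop± () _)
cut ⊥ₘ d₁ d₂ = invert ⊥⁺ (here refl) d₁
cut (¬ₘ A) d₁ d₂ = cut A (invert ¬± (here refl) d₂) (invert ¬± (here refl) d₁)
cut (A ∧ₘ B) d₁ d₂ =
  cut B (invert ∧⁺ (there (here refl)) d₁)
    (cut A (weaken (∷⁺ʳ _ there) (invert ∧⁺ (here refl) d₁)) (invert ∧⁻ (here refl) d₂))
cut (A ∨ₘ B) d₁ d₂ =
  cut B (cut A (invert ∨⁺ (here refl) d₁)
               (weaken (∷⁺ʳ _ there) (invert ∨⁻ (here refl) d₂)))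
    (invert ∨⁻ (there (here refl)) d₂)
cut (A ⇒ B) d₁ d₂ =
  cut B (cut A (weaken (∷⁺ʳ _ there) (invert ⇒⁻ (here refl) d₂))
               (invert ⇒⁺ (here refl) d₁))
    (invert ⇒⁻ (there (here refl)) d₂)
cut (□ A) {Δ} d₁ d₂ = remove pos principal d₁ id
  where
  principal : ∀ {Δ′} → Δ ⊆ Δ′ → Principal ((□ A) ⁺) Δ′ → ⊢ Δ′
  principal i (□⁺ Bs b d₀) = cut-□⁻ Bs (cut A) d₀ d₂ (∷⁺ʳ _ i) b
  principal i (prop± () _)
cut (V A) {Δ} d₁ d₂ = remove pos principal d₁ id
  where
  principal : ∀ {Δ′} → Δ ⊆ Δ′ → Principal ((V A) ⁺) Δ′ → ⊢ Δ′
  principal i (V⁺ Bs Cs b c d₀) = cut-V⁻ Bs Cs (cut A) d₀ d₂ (∷⁺ʳ _ i) b c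
  principal i (prop± () _)

-- Identity for arbitrary formulas

one : ∀ {P Γ} → ⊢ P ++ Γ → ∀ {Q} → Q ∈ P ∷ [] → ⊢ Q ++ Γ
one d (here refl) = d

two : ∀ {P P′ Γ} → ⊢ P ++ Γ → ⊢ P′ ++ Γ → ∀ {Q} → Q ∈ P ∷ P′ ∷ [] → ⊢ Q ++ Γ
two d d′ (here refl) = d
two d d′ (there m) = one d′ m

singleton⊆ : ∀ {a} {X : Set a} {x : X} {xs} → x ∈ xs → x ∷ [] ⊆ xs
singleton⊆ m (here refl) = m

pattern 0th = here refl
pattern 1st = there 0th
pattern 2nd = there 1st

identity : ∀ A {Γ} → A ⁺ ∈ Γ → A ⁻ ∈ Γ → ⊢ Γ
identity (var n) p q = atom p q
identity ⊥ₘ p q = prop q ⊥⁻ λ ()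
identity (¬ₘ A) p q = prop p ¬± (one (prop (there q) ¬± (one (identity A 0th 1st))))
identity (A ∧ₘ B) p q = prop q ∧⁻ (one (prop (there (there p)) ∧⁺
  (two (identity A 0th 1st) (identity B 0th 2nd))))
identity (A ∨ₘ B) p q = prop p ∨⁺ (one (prop (there (there q)) ∨⁻
  (two (identity A 1st 0th) (identity B 2nd 0th))))
identity (A ⇒ B) p q = prop p ⇒⁺ (one (prop (there (there q)) ⇒⁻
  (two (identity A 0th 1st) (identity B 2nd 0th))))
identity (□ A) p q = box⁺ (A ∷ []) p (singleton⊆ q) (box⁻ 1st (identity A 1st 0th))
identity (V A) p q = ver [] (A ∷ []) p (λ ()) (singleton⊆ q) (identity A 0th 1st)

-- Completeness for tautologies, after Kalmár

-- Only equality is certified: `literals-≔` tolerates any `nothing`, and `same-refl` provides the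
-- success that `cut-literals` relies on.
same : (A B : Fm) → Maybe (A ≡ B)
same (var m)  (var n)  = Maybe.map (cong var) (dec⇒maybe (m ≟ n))
same ⊥ₘ       ⊥ₘ       = just refl
same (¬ₘ A)   (¬ₘ B)   = Maybe.map (cong ¬ₘ_) (same A B)
same (A ∧ₘ B) (C ∧ₘ D) = Maybe.zipWith (cong₂ _∧ₘ_) (same A C) (same B D)
same (A ∨ₘ B) (C ∨ₘ D) = Maybe.zipWith (cong₂ _∨ₘ_) (same A C) (same B D)
same (A ⇒ B)  (C ⇒ D)  = Maybe.zipWith (cong₂ _⇒_) (same A C) (same B D)
same (□ A)    (□ B)    = Maybe.map (cong □_) (same A B)
same (V A)    (V B)    = Maybe.map (cong V_) (same A B)
same _        _        = nothing

same-refl : ∀ A → same A A ≡ just refl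
same-refl (var n) rewrite ≟-diag {n} refl = refl
same-refl ⊥ₘ = refl
same-refl (¬ₘ A) rewrite same-refl A = refl
same-refl (A ∧ₘ B) rewrite same-refl A | same-refl B = refl
same-refl (A ∨ₘ B) rewrite same-refl A | same-refl B = refl
same-refl (A ⇒ B) rewrite same-refl A | same-refl B = refl
same-refl (□ A) rewrite same-refl A = refl
same-refl (V A) rewrite same-refl A = refl

_[_≔_] : (Fm → Bool) → Fm → Bool → Fm → Bool
(v [ B ≔ b ]) C = Maybe.maybe′ (const b) (v C) (same B C)

-- The negation of the literal that v makes true.
literal : (Fm → Bool) → Fm → Signed
literal v A = not (v A) , A

literals-≔ : ∀ v B b As →
  map (literal (v [ B ≔ b ])) As ⊆ (not b , B) ∷ map (literal v) As
literals-≔ v B b (C ∷ As) (here refl) with same B C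
... | just refl = here refl
... | nothing = there (here refl)
literals-≔ v B b (C ∷ As) (there m) = ∷⁺ʳ _ there (literals-≔ v B b As m)

-- Each atom `B` is cut away between the derivations for its two values. As `B` may recur in `As`,
-- its changed literals there are contracted into the cut formula.
cut-literals : ∀ As {Δ} → (∀ v → ⊢ map (literal v) As ++ Δ) → ⊢ Δ
cut-literals [] f = f (const true)
cut-literals (B ∷ As) {Δ} f = cut-literals As λ v →
  cut B (weaken (resolve v false) (f (v [ B ≔ false ])))
        (weaken (resolve v true) (f (v [ B ≔ true ])))
  where
  resolve : ∀ v b → map (literal (v [ B ≔ b ])) (B ∷ As) ++ Δ ⊆
                    (not b , B) ∷ map (literal v) As ++ Δ
  resolve v b (here refl) rewrite same-refl B = here refl
  resolve v b (there m) = ++⁺ (literals-≔ v B b As) id m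

atoms : Fm → List Fm
atoms (var n)  = var n ∷ []
atoms ⊥ₘ       = []
atoms (¬ₘ A)   = atoms A
atoms (A ∧ₘ B) = atoms A ++ atoms B
atoms (A ∨ₘ B) = atoms A ++ atoms B
atoms (A ⇒ B)  = atoms A ++ atoms B
atoms (□ A)    = □ A ∷ []
atoms (V A)    = V A ∷ []

identity± : ∀ A b {Γ} → (b , A) ∈ Γ → (not b , A) ∈ Γ → ⊢ Γ
identity± A true  p q = identity A p q
identity± A false p q = identity A q p

map-++ˡ : ∀ {a b} {X : Set a} {Y : Set b} (f : X → Y) xs {ys} → map f xs ⊆ map f (xs ++ ys)
map-++ˡ f xs {ys} = map⁺ f (xs⊆xs++ys xs ys)

map-++ʳ : ∀ {a b} {X : Set a} {Y : Set b} (f : X → Y) xs {ys} → map f ys ⊆ map f (xs ++ ys)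
map-++ʳ f xs {ys} = map⁺ f (xs⊆ys++xs ys xs)

-- The hypotheses of Kalmár's lemma appear in `Γ` as negated literals, its conclusion as `A` signed
-- by its truth value; both stand in one sequent.
kalmár : ∀ v A {b Γ} → evalₘ v A ≡ b → map (literal v) (atoms A) ⊆ Γ → (b , A) ∈ Γ → ⊢ Γ
kalmár v (var n) {b} refl s p = identity± (var n) b p (s (here refl))
kalmár v (□ A) {b} refl s p = identity± (□ A) b p (s (here refl))
kalmár v (V A) {b} refl s p = identity± (V A) b p (s (here refl))
kalmár v ⊥ₘ refl s p = prop p ⊥⁻ λ ()
kalmár v (¬ₘ A) {b} e s p =
  prop p ¬± (one (kalmár v A (trans (sym (not-involutive _)) (cong not e)) (there ∘ s) 0th))
kalmár v (A ∧ₘ B) e s p with evalₘ v A in eA | evalₘ v B in eB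
kalmár v (A ∧ₘ B) refl s p | true | true = prop p ∧⁺
  (two (kalmár v A eA (there ∘ s ∘ map-++ˡ _ (atoms A)) 0th)
       (kalmár v B eB (there ∘ s ∘ map-++ʳ _ (atoms A)) 0th))
kalmár v (A ∧ₘ B) refl s p | true | false = prop p ∧⁻
  (one (kalmár v B eB (there ∘ there ∘ s ∘ map-++ʳ _ (atoms A)) 1st))
kalmár v (A ∧ₘ B) refl s p | false | _ = prop p ∧⁻
  (one (kalmár v A eA (there ∘ there ∘ s ∘ map-++ˡ _ (atoms A)) 0th))
kalmár v (A ∨ₘ B) e s p with evalₘ v A in eA | evalₘ v B in eB
kalmár v (A ∨ₘ B) refl s p | true | _ = prop p ∨⁺
  (one (kalmár v A eA (there ∘ there ∘ s ∘ map-++ˡ _ (atoms A)) 0th))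
kalmár v (A ∨ₘ B) refl s p | false | true = prop p ∨⁺
  (one (kalmár v B eB (there ∘ there ∘ s ∘ map-++ʳ _ (atoms A)) 1st))
kalmár v (A ∨ₘ B) refl s p | false | false = prop p ∨⁻
  (two (kalmár v A eA (there ∘ s ∘ map-++ˡ _ (atoms A)) 0th)
       (kalmár v B eB (there ∘ s ∘ map-++ʳ _ (atoms A)) 0th))
kalmár v (A ⇒ B) e s p with evalₘ v A in eA | evalₘ v B in eB
kalmár v (A ⇒ B) refl s p | false | _ = prop p ⇒⁺
  (one (kalmár v A eA (there ∘ there ∘ s ∘ map-++ˡ _ (atoms A)) 0th))
kalmár v (A ⇒ B) refl s p | true | true = prop p ⇒⁺
  (one (kalmár v B eB (there ∘ there ∘ s ∘ map-++ʳ _ (atoms A)) 1st))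
kalmár v (A ⇒ B) refl s p | true | false = prop p ⇒⁻
  (two (kalmár v A eA (there ∘ s ∘ map-++ˡ _ (atoms A)) 0th)
       (kalmár v B eB (there ∘ s ∘ map-++ʳ _ (atoms A)) 0th))

tautology : ∀ {A} → TautologyS4V A → ⊢ A ⁺ ∷ []
tautology {A} t = cut-literals (atoms A) λ v →
  kalmár v A (t v) (xs⊆xs++ys _ _) (xs⊆ys++xs _ (map (literal v) (atoms A)) 0th)

-- Embedding S4V into the calculus

⇒-intro : ∀ {A B Γ} → (A ⇒ B) ⁺ ∈ Γ → ⊢ A ⁻ ∷ B ⁺ ∷ Γ → ⊢ Γ
⇒-intro p d = prop p ⇒⁺ (one d)

⇒-elim : ∀ {A B Γ} → (A ⇒ B) ⁻ ∈ Γ → A ⁻ ∈ Γ → B ⁺ ∈ Γ → ⊢ Γ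
⇒-elim {A} {B} p q r = prop p ⇒⁻ (two (identity A 0th (there q)) (identity B (there r) 0th))

-- The modal axioms have short cut-free derivations; cut enters through modus ponens and
-- `tautology`.
complete : ∀ {A} → S4V⊢ A → ⊢ A ⁺ ∷ []
complete (taut t) = tautology t
complete (axK {A} {B}) = ⇒-intro 0th (⇒-intro 1st
  (box⁺ (A ∷ (A ⇒ B) ∷ []) 1st (λ { 0th → 0th ; 1st → 2nd })
    (box⁻ 1st (box⁻ (there 2nd) (⇒-elim 0th 1st 2nd)))))
complete (axT {A}) = ⇒-intro 0th (box⁻ 0th (identity A 2nd 0th))
complete (ax4 {A}) = ⇒-intro 0th (box⁺ (A ∷ []) 1st (singleton⊆ 0th) (identity (□ A) 0th 1st))
complete (axVK {A} {B}) = ⇒-intro 0th (⇒-intro 1st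
  (ver [] (A ∷ (A ⇒ B) ∷ []) 1st (λ ()) (λ { 0th → 0th ; 1st → 2nd })
    (⇒-elim 2nd 1st 0th)))
complete (ax□V {A}) = ⇒-intro 0th (ver (A ∷ []) [] 1st (singleton⊆ 0th) (λ ())
  (box⁻ 1st (identity A 1st 0th)))
complete axC = prop 0th ¬± (one (con (V ⊥ₘ ∷ []) (singleton⊆ 0th)
  (box⁻ 1st (identity (V ⊥ₘ) 1st 0th))))
complete (mp {A} d₁ d₂) =
  cut A (weaken (∷⁺ʳ _ λ ()) (complete d₂)) (invert ⇒⁺ (here refl) (complete d₁))
complete (nec d) = box⁺ [] 0th (λ ()) (complete d)

-- Propositional reasoning in LPV

infix 4 _⊨_

-- A record rather than the bare equation: `evalˡ` computes, and unification could not recover `X`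
-- from its value.
record _⊨_ (v : LFm → Bool) (X : LFm) : Set where
  constructor holds
  field evaluates : evalˡ v X ≡ true

open _⊨_

module _ {v : LFm → Bool} where

  ⊨⊥⁻ : ∀ {a} {Z : Set a} → v ⊨ ⊥ˡ → Z
  ⊨⊥⁻ (holds ())

  ⊨-dec : ∀ X → v ⊨ X ⊎ v ⊨ ¬ˡ X
  ⊨-dec X with evalˡ v X in e
  ... | true  = inj₁ (holds e)
  ... | false = inj₂ (holds (cong not e))

  ⊨¬⁻ : ∀ {a} {Z : Set a} {X} → v ⊨ ¬ˡ X → v ⊨ X → Z
  ⊨¬⁻ (holds n) (holds p) rewrite p with () ← n

  ⊨¬⁺ : ∀ {X} → (v ⊨ X → v ⊨ ⊥ˡ) → v ⊨ ¬ˡ X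
  ⊨¬⁺ {X} f = [ ⊨⊥⁻ ∘ f , id ]′ (⊨-dec X)

  ⊨⇒⁺ : ∀ {X Y} → (v ⊨ X → v ⊨ Y) → v ⊨ X ⇒ˡ Y
  ⊨⇒⁺ {X} f with ⊨-dec X
  ... | inj₁ p = holds (trans (cong (λ b → not b ∨ _) (evaluates p)) (evaluates (f p)))
  ... | inj₂ (holds n) = holds (cong (_∨ _) n)

  ⊨⇒⁻ : ∀ {X Y} → v ⊨ X ⇒ˡ Y → v ⊨ X → v ⊨ Y
  ⊨⇒⁻ (holds e) (holds p) rewrite p = holds e

  ⊨∧⁺ : ∀ {X Y} → v ⊨ X → v ⊨ Y → v ⊨ X ∧ˡ Y
  ⊨∧⁺ (holds p) (holds q) = holds (cong₂ _∧_ p q)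

  ⊨∧⁻ : ∀ {X Y} → v ⊨ X ∧ˡ Y → v ⊨ X × v ⊨ Y
  ⊨∧⁻ {X} {Y} (holds e) with evalˡ v X in p | evalˡ v Y in q
  ... | true | true = holds p , holds q

  ⊨∨⁺ˡ : ∀ {X Y} → v ⊨ X → v ⊨ X ∨ˡ Y
  ⊨∨⁺ˡ (holds p) = holds (cong (_∨ _) p)

  ⊨∨⁺ʳ : ∀ {X Y} → v ⊨ Y → v ⊨ X ∨ˡ Y
  ⊨∨⁺ʳ {X} (holds q) = holds (trans (cong (evalˡ v X ∨_) q) (∨-zeroʳ _))

  ⊨∨⁻ : ∀ {X Y} → v ⊨ X ∨ˡ Y → v ⊨ X ⊎ v ⊨ Y
  ⊨∨⁻ {X} (holds e) with evalˡ v X in p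
  ... | true  = inj₁ (holds p)
  ... | false = inj₂ (holds e)

tautologous : ∀ {X} → (∀ {v} → v ⊨ X) → TautologyLPV X
tautologous f v = evaluates (f {v})

-- The realisation and the reading of sequents

𝐱 : Tm
𝐱 = pvar 0

assign : Tm → Bool → (A : Fm) → Realisation A
assign T b (var n)  = tt
assign T b ⊥ₘ       = tt
assign T b (¬ₘ A)   = assign T (not b) A
assign T b (A ∧ₘ B) = assign T b A , assign T b B
assign T b (A ∨ₘ B) = assign T b A , assign T b B
assign T b (A ⇒ B)  = assign T (not b) A , assign T b B
assign T true  (□ A) = T , assign T true A
assign T false (□ A) = 𝐱 , assign T false A
assign T b (V A)    = assign T b A

assign-normal : ∀ T b A → NormalAt b A (assign T b A)
assign-normal T b (var n)  = tt
assign-normal T b ⊥ₘ       = tt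
assign-normal T b (¬ₘ A)   = assign-normal T (not b) A
assign-normal T b (A ∧ₘ B) = assign-normal T b A , assign-normal T b B
assign-normal T b (A ∨ₘ B) = assign-normal T b A , assign-normal T b B
assign-normal T b (A ⇒ B)  = assign-normal T (not b) A , assign-normal T b B
assign-normal T true  (□ A) = assign-normal T true A
assign-normal T false (□ A) = (0 , refl) , assign-normal T false A
assign-normal T true  (V A) = assign-normal T true A
assign-normal T false (V A) = assign-normal T false A

⟦_⟧ : Signed → Tm → LFm
⟦ A ⁺ ⟧ T = realise A (assign T true A)
⟦ A ⁻ ⟧ T = ¬ˡ realise A (assign T false A)

ante : Tm → Fm → LFm
ante T A = realise A (assign T false A)

⋁ : Tm → Sequent → LFm
⋁ T = foldr (λ φ → ⟦ φ ⟧ T ∨ˡ_) ⊥ˡ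

Holds : (LFm → Bool) → Tm → Sequent → Set
Holds v T = Any (λ φ → v ⊨ ⟦ φ ⟧ T)

⋁⁺ : ∀ {v T Γ} → Holds v T Γ → v ⊨ ⋁ T Γ
⋁⁺ (here p)  = ⊨∨⁺ˡ p
⋁⁺ (there p) = ⊨∨⁺ʳ (⋁⁺ p)

⋁⁻ : ∀ {v T} Γ → v ⊨ ⋁ T Γ → Holds v T Γ
⋁⁻ [] p = ⊨⊥⁻ p
⋁⁻ (φ ∷ Γ) p = [ here , there ∘ ⋁⁻ Γ ]′ (⊨∨⁻ p)

infix 6 _⟹⟨_⟩_

-- The curried form of a sequent, since `app` and `vK` distribute over implications and not over
-- disjunctions.
_⟹⟨_⟩_ : List Fm → Tm → LFm → LFm
Θ ⟹⟨ T ⟩ Y = foldr (λ B → ante T B ⇒ˡ_) Y Θ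

⟹⁻ : ∀ {v T} Θ {Y} → v ⊨ Θ ⟹⟨ T ⟩ Y → Holds v T (neg Θ) ⊎ v ⊨ Y
⟹⁻ [] p = inj₂ p
⟹⁻ {T = T} (B ∷ Θ) p with ⊨-dec (ante T B)
... | inj₂ n = inj₁ (here n)
... | inj₁ q = Sum.map₁ there (⟹⁻ Θ (⊨⇒⁻ p q))

⟹⁺ : ∀ {v T} Θ {Y} → Holds v T (neg Θ) ⊎ v ⊨ Y → v ⊨ Θ ⟹⟨ T ⟩ Y
⟹⁺ [] (inj₂ p) = p
⟹⁺ (B ∷ Θ) (inj₁ (here n)) = ⊨⇒⁺ (⊨¬⁻ n)
⟹⁺ (B ∷ Θ) (inj₁ (there m)) = ⊨⇒⁺ λ _ → ⟹⁺ Θ (inj₁ m)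
⟹⁺ (B ∷ Θ) (inj₂ p) = ⊨⇒⁺ λ _ → ⟹⁺ Θ (inj₂ p)

⟶-sound : ∀ {v T φ Ps} → φ ⟶ Ps → All (Holds v T) Ps → v ⊨ ⟦ φ ⟧ T
⟶-sound ⊥⁺ (() ∷ [])
⟶-sound ⊥⁻ [] = ⊨¬⁺ id
⟶-sound (¬± {true}) (here p ∷ []) = p
⟶-sound (¬± {false}) (here p ∷ []) = ⊨¬⁺ λ n → ⊨¬⁻ n p
⟶-sound ∧⁺ (here p ∷ here q ∷ []) = ⊨∧⁺ p q
⟶-sound ∧⁻ (here n ∷ []) = ⊨¬⁺ (⊨¬⁻ n ∘ proj₁ ∘ ⊨∧⁻)
⟶-sound ∧⁻ (there (here n) ∷ []) = ⊨¬⁺ (⊨¬⁻ n ∘ proj₂ ∘ ⊨∧⁻)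
⟶-sound ∨⁺ (here p ∷ []) = ⊨∨⁺ˡ p
⟶-sound ∨⁺ (there (here q) ∷ []) = ⊨∨⁺ʳ q
⟶-sound ∨⁻ (here m ∷ here n ∷ []) = ⊨¬⁺ ([ ⊨¬⁻ m , ⊨¬⁻ n ]′ ∘ ⊨∨⁻)
⟶-sound ⇒⁺ (here n ∷ []) = ⊨⇒⁺ (⊨¬⁻ n)
⟶-sound ⇒⁺ (there (here q) ∷ []) = ⊨⇒⁺ (const q)
⟶-sound ⇒⁻ (here p ∷ here n ∷ []) = ⊨¬⁺ λ f → ⊨¬⁻ n (⊨⇒⁻ f p)

contexts-out : ∀ {v T Γ} Ps → All (λ P → Holds v T (P ++ Γ)) Ps →
               Holds v T Γ ⊎ All (Holds v T) Ps
contexts-out [] [] = inj₂ []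
contexts-out (P ∷ Ps) (h ∷ hs) with Any.++⁻ P h | contexts-out Ps hs
... | inj₂ g | _      = inj₁ g
... | inj₁ p | inj₁ g = inj₁ g
... | inj₁ p | inj₂ ps = inj₂ (p ∷ ps)

-- Internalised reasoning

infix 4 _⊩_
infixl 8 _∙_

_⊩_ : Tm → LFm → Set
t ⊩ X = LPV⊢ (t ∶ X)

_∙_ : ∀ {s t X Y} → s ⊩ X ⇒ˡ Y → t ⊩ X → s · t ⊩ Y
p ∙ q = mp (mp (ax app) p) q

𝐜 : Tm
𝐜 = pconst 0

axiom : ∀ {X} → LPVAxiom X → 𝐜 ⊩ X
axiom = anec 0

internalise : ∀ {t X} → t ⊩ X → ! t ⊩ t ∶ X
internalise p = mp (ax check) p

byTautology : ∀ {X} → (∀ {v} → v ⊨ X) → 𝐜 ⊩ X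
byTautology f = axiom (taut (tautologous f))

identityˡ : ∀ {X} → 𝐜 ⊩ X ⇒ˡ X
identityˡ = byTautology (⊨⇒⁺ id)

compose : ∀ {X Y Z} → 𝐜 ⊩ (X ⇒ˡ Y) ⇒ˡ (Y ⇒ˡ Z) ⇒ˡ X ⇒ˡ Z
compose = byTautology (⊨⇒⁺ λ f → ⊨⇒⁺ λ g → ⊨⇒⁺ λ x → ⊨⇒⁻ g (⊨⇒⁻ f x))

-- The step common to the lifting lemmas: distribute the modality over one implication, treat the
-- remaining antecedents, and bring the antecedent itself under the modality.
distribute : ∀ {P X Q R X′} →
  𝐜 ⊩ (P ⇒ˡ X ⇒ˡ Q) ⇒ˡ (Q ⇒ˡ R) ⇒ˡ (X′ ⇒ˡ X) ⇒ˡ P ⇒ˡ X′ ⇒ˡ R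
distribute = byTautology (⊨⇒⁺ λ f → ⊨⇒⁺ λ g → ⊨⇒⁺ λ h → ⊨⇒⁺ λ p → ⊨⇒⁺ λ x′ →
  ⊨⇒⁻ g (⊨⇒⁻ (⊨⇒⁻ f p) (⊨⇒⁻ h x′)))

-- Each antecedent `𝐱 ∶ B` gives `! 𝐱 ∶ (𝐱 ∶ B)`, so `s′` is `s` applied to one `! 𝐱` per
-- antecedent. Both terms are fixed before `T` and `Y`.
lift-term : ∀ Bs s → ∃ λ f → ∃ λ s′ → ∀ T Y →
  f ⊩ s ∶ (map □_ Bs ⟹⟨ T ⟩ Y) ⇒ˡ (map □_ Bs ⟹⟨ T ⟩ s′ ∶ Y)
lift-term [] s = 𝐜 , s , λ T Y → identityˡ
lift-term (B ∷ Bs) s with lift-term Bs (s · ! 𝐱)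
... | f , s′ , p = _ , s′ , λ T Y →
  distribute ∙ axiom app ∙ p T Y ∙ axiom check

lift-V : ∀ Cs → ∃ λ f → ∀ T Y →
  f ⊩ Vˡ (Cs ⟹⟨ T ⟩ Y) ⇒ˡ (map V_ Cs ⟹⟨ T ⟩ Vˡ Y)
lift-V [] = 𝐜 , λ T Y → identityˡ
lift-V (C ∷ Cs) with lift-V Cs
... | f , p = _ , λ T Y → distribute ∙ axiom vK ∙ p T Y ∙ identityˡ

lift-V□ : ∀ Bs → ∃ λ f → ∀ T Y →
  f ⊩ Vˡ (map □_ Bs ⟹⟨ T ⟩ Y) ⇒ˡ (map □_ Bs ⟹⟨ T ⟩ Vˡ Y)
lift-V□ [] = 𝐜 , λ T Y → identityˡ
lift-V□ (B ∷ Bs) with lift-V□ Bs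
... | f , p = _ , λ T Y →
  -- A boxed antecedent passes under `V` by positive introspection followed by `jV`.
  distribute ∙ axiom vK ∙ p T Y ∙ (compose ∙ axiom check ∙ axiom jV)

-- Realising cut-free derivations

-- One term `w` serves every `X`, hence also the formulas in which `T` itself occurs.
Absorbs : Tm → Tm → Tm → Set
Absorbs w S T = ∀ {X} → w ⊩ S ∶ X ⇒ˡ T ∶ X

-- A state monad which collects the summands of T in the context K.  The result
-- c and the absorption witnesses w, w′ must be found before T is known: T will
-- contain the terms that are being built.
Uniformly : {C : Set} → (C → Tm → Set) → Set
Uniformly {C} Q = ∀ w → ∃ λ (c : C) → ∃ λ w′ → ∃ λ (K : Tm → Tm) →
  ∀ T U → Absorbs w (K U) T → Absorbs w′ U T × Q c T

return : ∀ {C : Set} {Q : C → Tm → Set} c → (∀ {T} → Q c T) → Uniformly Q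
return c q w = c , w , id , λ T U a → a , q

transform : ∀ {C D : Set} {Q : C → Tm → Set} {R : D → Tm → Set} (f : C → D) →
            (∀ {c T} → Q c T → R (f c) T) → Uniformly Q → Uniformly R
transform f g m w with m w
... | c , w′ , K , h = f c , w′ , K , λ T U a → map₂ g (h T U a)

both : ∀ {C D : Set} {Q : C → Tm → Set} {R : D → Tm → Set} → Uniformly Q → Uniformly R →
       Uniformly {C × D} (λ (c , d) T → Q c T × R d T)
both m n w with m w
... | c , w₁ , K₁ , g with n w₁
-- The summands of the second computation go into the hole of the first, whose absorption witness is
-- handed on to the second.
... | d , w₂ , K₂ , h = (c , d) , w₂ , K₁ ∘ K₂ , λ T U a →
  let a₁ , q = g T (K₂ U) a ; a₂ , r = h T U a₁ in a₂ , q , r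

Realised : Sequent → Set
Realised Γ = Uniformly λ t T → t ⊩ ⋁ T Γ

_⇛⟨_⟩_ : List Sequent → Tm → LFm → LFm
Ps ⇛⟨ T ⟩ Y = foldr (λ P → ⋁ T P ⇒ˡ_) Y Ps

⇛⁺ : ∀ {v T Y} Ps → (All (Holds v T) Ps → v ⊨ Y) → v ⊨ Ps ⇛⟨ T ⟩ Y
⇛⁺ [] f = f []
⇛⁺ (P ∷ Ps) f = ⊨⇒⁺ λ p → ⇛⁺ Ps (f ∘ (⋁⁻ P p ∷_))

-- The number of premises varies with the rule, so the result is a function that applies a term `u`
-- for the whole implication to the terms of the premises in turn.
discharge : ∀ {Γ} Ps → (∀ {P} → P ∈ Ps → Realised (P ++ Γ)) →
            Uniformly {Tm → Tm} λ g T → ∀ u Y → u ⊩ map (_++ Γ) Ps ⇛⟨ T ⟩ Y → g u ⊩ Y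
discharge [] rs = return id λ _ _ → id
discharge (P ∷ Ps) rs =
  transform (λ (t , g) u → g (u · t)) (λ (p , q) u Y r → q _ Y (r ∙ p))
    (both (rs (here refl)) (discharge Ps (rs ∘ there)))

antecedents : ∀ {A T} Θ → 𝐜 ⊩ ⋁ T (A ⁺ ∷ neg Θ) ⇒ˡ (Θ ⟹⟨ T ⟩ ⟦ A ⁺ ⟧ T)
antecedents {A} {T} Θ = byTautology (⊨⇒⁺ (sort ∘ ⋁⁻ (A ⁺ ∷ neg Θ)))
  where
  sort : ∀ {v} → Holds v T (A ⁺ ∷ neg Θ) → v ⊨ Θ ⟹⟨ T ⟩ ⟦ A ⁺ ⟧ T
  sort (here p)  = ⟹⁺ Θ (inj₂ p)
  sort (there m) = ⟹⁺ Θ (inj₁ m)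

antecedents₂ : ∀ {A T} Θ Ξ →
  𝐜 ⊩ ⋁ T (A ⁺ ∷ neg Θ ++ neg Ξ) ⇒ˡ (Θ ⟹⟨ T ⟩ (Ξ ⟹⟨ T ⟩ ⟦ A ⁺ ⟧ T))
antecedents₂ {A} {T} Θ Ξ = byTautology (⊨⇒⁺ (sort ∘ ⋁⁻ (A ⁺ ∷ neg Θ ++ neg Ξ)))
  where
  sort : ∀ {v} → Holds v T (A ⁺ ∷ neg Θ ++ neg Ξ) → v ⊨ Θ ⟹⟨ T ⟩ (Ξ ⟹⟨ T ⟩ ⟦ A ⁺ ⟧ T)
  sort (here p)  = ⟹⁺ Θ (inj₂ (⟹⁺ Ξ (inj₂ p)))
  sort (there m) = ⟹⁺ Θ (Sum.map₂ (⟹⁺ Ξ ∘ inj₁) (Any.++⁻ (neg Θ) m))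

-- `t′` is the term for a new box: the internalised premise, with its boxed side formulas discharged
-- by `lift-term`.
justify : ∀ Bs t → ∃ λ f → ∃ λ t′ → ∀ {A T} → t ⊩ ⋁ T (A ⁺ ∷ neg□ Bs) →
          f ⊩ map □_ Bs ⟹⟨ T ⟩ t′ ∶ ⟦ A ⁺ ⟧ T
justify Bs t with lift-term Bs (𝐜 · t)
... | f , t′ , l = _ , t′ , λ {A} {T} r →
  l T (⟦ A ⁺ ⟧ T) ∙ internalise (antecedents {A} (map □_ Bs) ∙ r)

absorbˡ : ∀ {w s U T} → Absorbs w (s +ₜ U) T → Absorbs (𝐜 · 𝐜 · w) s T
absorbˡ a = compose ∙ axiom sumʳ ∙ a

absorbʳ : ∀ {w s U T} → Absorbs w (s +ₜ U) T → Absorbs (𝐜 · 𝐜 · w) U T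
absorbʳ a = compose ∙ axiom sumˡ ∙ a

realised : ∀ {Γ} → ⊢ Γ → Realised Γ
realised (atom p q) = return 𝐜 (byTautology (⋁⁺ ([ lose p , lose q ]′ (⊨-dec _))))
-- The implication from the premises to the conclusion is a tautology, hence justified by `𝐜`.
realised (prop {Ps = Ps} p e ds) = transform (λ g → g 𝐜)
  (λ r → r _ _ (byTautology (⇛⁺ _
    (⋁⁺ ∘ [ id , lose p ∘ ⟶-sound e ]′ ∘ contexts-out Ps ∘ All.map⁻))))
  (discharge Ps (λ m → realised (ds m)))
realised {Γ} (box⁻ {A} p d) =
  transform (λ t → 𝐜 · 𝐜 · t) (λ r → unbox ∙ axiom refl ∙ r) (realised d)
  where
  unbox : ∀ {T} → 𝐜 ⊩ (𝐱 ∶ ante T A ⇒ˡ ante T A) ⇒ˡ ⋁ T (A ⁻ ∷ Γ) ⇒ˡ ⋁ T Γ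
  unbox = byTautology (⊨⇒⁺ λ f → ⊨⇒⁺ λ h → ⋁⁺
    ([ (λ n → lose p (⊨¬⁺ (⊨¬⁻ n ∘ ⊨⇒⁻ f))) , ⋁⁻ Γ ]′ (⊨∨⁻ h)))
realised {Γ} (box⁺ {A} Bs p s d) w with realised d w
... | t , w′ , K , h with justify Bs t
-- The only rule that adds a summand: `t′` enters the hole, and `U` keeps it open for later ones.
-- Absorption then turns `t′` into `T`.
... | f , t′ , l = _ , _ , (λ U → K (t′ +ₜ U)) , λ T U a →
  let a′ , r = h T (t′ +ₜ U) a in absorbʳ a′ , (rebox ∙ l {A} {T} r ∙ absorbˡ a′)
  where
  rebox : ∀ {T t} → 𝐜 ⊩ (map □_ Bs ⟹⟨ T ⟩ t ∶ ⟦ A ⁺ ⟧ T) ⇒ˡ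
                         (t ∶ ⟦ A ⁺ ⟧ T ⇒ˡ T ∶ ⟦ A ⁺ ⟧ T) ⇒ˡ ⋁ T Γ
  rebox = byTautology (⊨⇒⁺ λ g → ⊨⇒⁺ λ i → ⋁⁺
    ([ Any-resp-⊆ s , lose p ∘ ⊨⇒⁻ i ]′ (⟹⁻ (map □_ Bs) g)))
realised {Γ} (ver {A} Bs Cs p s u d) with lift-V□ Bs | lift-V Cs
... | f , k | g , l =
  -- The premise is internalised and put under `V` by `jV`; then the boxed antecedents are moved
  -- out, and after them the `V`-antecedents.
  transform _
    (λ {t} {T} r → verify
      ∙ (k T _ ∙ (axiom jV ∙ internalise (antecedents₂ {A} (map □_ Bs) Cs ∙ r)))
      ∙ l T _)
    (realised d)
  where
  verify : ∀ {T} → let Z = Cs ⟹⟨ T ⟩ ⟦ A ⁺ ⟧ T in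
    𝐜 ⊩ (map □_ Bs ⟹⟨ T ⟩ Vˡ Z) ⇒ˡ
         (Vˡ Z ⇒ˡ (map V_ Cs ⟹⟨ T ⟩ Vˡ ⟦ A ⁺ ⟧ T)) ⇒ˡ ⋁ T Γ
  verify = byTautology (⊨⇒⁺ λ g → ⊨⇒⁺ λ i → ⋁⁺
    ([ Any-resp-⊆ s , [ Any-resp-⊆ u , lose p ]′ ∘ ⟹⁻ (map V_ Cs) ∘ ⊨⇒⁻ i ]′
      (⟹⁻ (map □_ Bs) g)))
realised {Γ} (con Bs s d) =
  transform (λ t → 𝐜 · proj₁ (justify Bs t) · 𝐜)
    -- `justify` yields a term for `V ⊥`, which the axiom `cons` refutes, so one of the boxed side
    -- formulas must hold.
    (λ {t} {T} r → refute ∙ proj₂ (proj₂ (justify Bs t)) {V ⊥ₘ} {T} r ∙ axiom cons)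
    (realised d)
  where
  refute : ∀ {T X} → 𝐜 ⊩ (map □_ Bs ⟹⟨ T ⟩ X) ⇒ˡ ¬ˡ X ⇒ˡ ⋁ T Γ
  refute = byTautology (⊨⇒⁺ λ g → ⊨⇒⁺ λ n → ⋁⁺
    ([ Any-resp-⊆ s , ⊨¬⁻ n ]′ (⟹⁻ (map □_ Bs) g)))

theorem7 : (F : Fm) → S4V⊢ F →
    Σ (Realisation F) (λ r → Normal F r × LPV⊢ realise F r)
-- The choice of `T` is `K 𝐱`, where `𝐱` is an arbitrary filler of the hole. As `T` is then the
-- whole sum, the initial absorption is an identity, witnessed by `𝐜`.
theorem7 F d with realised (complete d) 𝐜
... | t , w , K , h = assign (K 𝐱) true F , assign-normal (K 𝐱) true F ,
  mp (ax (taut (tautologous {⋁ (K 𝐱) (F ⁺ ∷ []) ⇒ˡ ⟦ F ⁺ ⟧ (K 𝐱)}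
                 (⊨⇒⁺ ([ id , ⊨⊥⁻ ]′ ∘ ⊨∨⁻)))))
     -- Reflection strips the internalising term from the final result.
     (mp (ax refl) (proj₂ (h (K 𝐱) 𝐱 identityˡ)))
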